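{- Let $\sigma>0$ and $0<\alpha<\tfrac12$. Let $p(x)=\sigma$ be the constant function and let $f(x)=\frac{\sigma}{\alpha}\max\left(0,\,x-(1-2\alpha)\right)$ on $[-1,1]$. (Note that $|p(x)-f(x)|\le\sigma$ for all $x\in[-1,1]$.) Let $$q=\operatorname*{arg\,min}_{r}\ \|f-r\|_\infty$$ be the result of $\ell_\infty$ projection of $f$, where the minimum is over real polynomials $r$ of degree at most $1$. Then $$\|p-q\|_\infty\ge(2-\alpha)\sigma .$$
   Context: $\|g\|_\infty=\sup_{x\in[-1,1]}|g(x)|$. -}

module Defs where

open import Data.Nat.Base as ℕ using (ℕ; suc)
import Data.Nat.Properties as ℕ
open import Data.Product using (∃-syntax; _×_; _,_)
open import Data.Rational.Base as ℚ using (ℚ; 0ℚ; 1ℚ)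
import Data.Rational.Properties as ℚ
open import Data.Rational.Solver using (module +-*-Solver)
open import Data.Sum using (inj₁; inj₂)
open import Data.Vec.Base using (Vec; foldr′)
open import Relation.Binary.PropositionalEquality
  using (_≡_; refl; sym; trans; cong; cong₂)

module RationalLemmas where
  open import Data.Rational.Base
  open import Data.Rational.Properties
  open +-*-Solver

  0<⇒0≤ : ∀ {p} → 0ℚ < p → 0ℚ ≤ p
  0<⇒0≤ = <⇒≤

  0<+ : ∀ {p q} → 0ℚ < p → 0ℚ < q → 0ℚ < p + q
  0<+ = +-mono-<

  0<* : ∀ {p q} → 0ℚ < p → 0ℚ < q → 0ℚ < p * q
  0<* {p} {q} 0<p 0<q =
    positive⁻¹ (p * q) {{pos*pos⇒pos p {{positive 0<p}} q {{positive 0<q}}}}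

  *-monoˡ : ∀ {p q} r → 0ℚ ≤ r → p ≤ q → r * p ≤ r * q
  *-monoˡ r 0≤r = *-monoˡ-≤-nonNeg r {{nonNegative 0≤r}}

  *-monoʳ : ∀ {p q} r → 0ℚ ≤ r → p ≤ q → p * r ≤ q * r
  *-monoʳ r 0≤r = *-monoʳ-≤-nonNeg r {{nonNegative 0≤r}}

  p≤∣p∣ : ∀ p → p ≤ ∣ p ∣
  p≤∣p∣ p with ≤-total 0ℚ p
  ... | inj₁ 0≤p = ≤-reflexive (sym (0≤p⇒∣p∣≡p 0≤p))
  ... | inj₂ p≤0 = ≤-trans p≤0 (0≤∣p∣ p)

  ∣p-q∣≡∣q-p∣ : ∀ p q → ∣ p - q ∣ ≡ ∣ q - p ∣
  ∣p-q∣≡∣q-p∣ p q = trans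
    (cong ∣_∣ (solve 2 (λ a b → a :- b := :- (b :- a)) refl p q))
    (∣-p∣≡∣p∣ (q - p))

  p≤q+∣p-q∣ : ∀ p q → p ≤ q + ∣ p - q ∣
  p≤q+∣p-q∣ p q = ≤-trans
    (≤-reflexive (solve 2 (λ a b → a := b :+ (a :- b)) refl p q))
    (+-monoʳ-≤ q (p≤∣p∣ (p - q)))

  p≤q+r⇒p-q≤r : ∀ p q r → p ≤ q + r → p - q ≤ r
  p≤q+r⇒p-q≤r p q r h = ≤-trans (+-monoˡ-≤ (- q) h)
    (≤-reflexive (solve 2 (λ b c → (b :+ c) :- b := c) refl q r))

  ∣-∣-lub : ∀ p q r → p ≤ q + r → q ≤ p + r → ∣ p - q ∣ ≤ r
  ∣-∣-lub p q r p≤ q≤ with ∣p∣≡p∨∣p∣≡-p (p - q)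
  ... | inj₁ e = ≤-trans (≤-reflexive e) (p≤q+r⇒p-q≤r p q r p≤)
  ... | inj₂ e = ≤-trans (≤-reflexive (trans e
      (solve 2 (λ a b → :- (a :- b) := b :- a) refl p q)))
      (p≤q+r⇒p-q≤r q p r q≤)

  ∣+∣-close : ∀ a b c d → ∣ (a + b) - (c + d) ∣ ≤ ∣ a - c ∣ + ∣ b - d ∣
  ∣+∣-close a b c d = ≤-trans
    (≤-reflexive (cong ∣_∣ (solve 4
      (λ a b c d → (a :+ b) :- (c :+ d) := (a :- c) :+ (b :- d)) refl a b c d)))
    (∣p+q∣≤∣p∣+∣q∣ (a - c) (b - d))

  ∣*∣-close : ∀ a b c d →
    ∣ (a * b) - (c * d) ∣ ≤ ∣ a ∣ * ∣ b - d ∣ + ∣ d ∣ * ∣ a - c ∣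
  ∣*∣-close a b c d = ≤-trans
    (≤-reflexive (cong ∣_∣ (solve 4
      (λ a b c d → (a :* b) :- (c :* d) := (a :* (b :- d)) :+ (d :* (a :- c)))
      refl a b c d)))
    (≤-trans (∣p+q∣≤∣p∣+∣q∣ (a * (b - d)) (d * (a - c)))
      (≤-reflexive (cong₂ _+_ (∣p*q∣≡∣p∣*∣q∣ a (b - d)) (∣p*q∣≡∣p∣*∣q∣ d (a - c)))))

  *-mono : ∀ a b c d → 0ℚ ≤ a → 0ℚ ≤ d → a ≤ c → b ≤ d → a * b ≤ c * d
  *-mono a b c d 0≤a 0≤d a≤c b≤d =
    ≤-trans {a * b} {a * d} {c * d} (*-monoˡ a 0≤a b≤d) (*-monoʳ d 0≤d a≤c)

  ∣*∣-close-≤ : ∀ a b c d A D δ → 0ℚ ≤ δ → ∣ a ∣ ≤ A → ∣ d ∣ ≤ D →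
    ∣ a - c ∣ ≤ δ → ∣ b - d ∣ ≤ δ → ∣ (a * b) - (c * d) ∣ ≤ (A + D) * δ
  ∣*∣-close-≤ a b c d A D δ 0≤δ a≤A d≤D ac bd =
    ≤-trans (∣*∣-close a b c d)
      (≤-trans {_} {A * δ + D * δ}
        (+-mono-≤ {∣ a ∣ * ∣ b - d ∣} {A * δ} {∣ d ∣ * ∣ a - c ∣} {D * δ}
          (*-mono ∣ a ∣ ∣ b - d ∣ A δ (0≤∣p∣ a) 0≤δ a≤A bd)
          (*-mono ∣ d ∣ ∣ a - c ∣ D δ (0≤∣p∣ d) 0≤δ d≤D ac))
        (≤-reflexive (sym (*-distribʳ-+ δ A D))))

  ⊔-upper : ∀ a b c d → a ⊔ b ≤ (c ⊔ d) + (∣ a - c ∣ + ∣ b - d ∣)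
  ⊔-upper a b c d = ⊔-lub
    (≤-trans (p≤q+∣p-q∣ a c) (+-mono-≤ (p≤p⊔q c d)
      (≤-trans (≤-reflexive (sym (+-identityʳ ∣ a - c ∣))) (+-monoʳ-≤ ∣ a - c ∣ (0≤∣p∣ (b - d))))))
    (≤-trans (p≤q+∣p-q∣ b d) (+-mono-≤ (p≤q⊔p c d)
      (≤-trans (≤-reflexive (sym (+-identityˡ ∣ b - d ∣))) (+-monoˡ-≤ ∣ b - d ∣ (0≤∣p∣ (a - c))))))

  ∣⊔∣-close : ∀ a b c d → ∣ (a ⊔ b) - (c ⊔ d) ∣ ≤ ∣ a - c ∣ + ∣ b - d ∣
  ∣⊔∣-close a b c d = ∣-∣-lub (a ⊔ b) (c ⊔ d) _ (⊔-upper a b c d)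
    (≤-trans (⊔-upper c d a b) (≤-reflexive (cong ((a ⊔ b) +_)
      (cong₂ _+_ (∣p-q∣≡∣q-p∣ c a) (∣p-q∣≡∣q-p∣ d b)))))

  recip : ∀ p → 0ℚ < p → ℚ
  recip p 0<p = (1/ p) {{>-nonZero 0<p}}

  *-recip : ∀ p (0<p : 0ℚ < p) → p * recip p 0<p ≡ 1ℚ
  *-recip p 0<p = *-inverseʳ p {{>-nonZero 0<p}}

  0<recip : ∀ p (0<p : 0ℚ < p) → 0ℚ < recip p 0<p
  0<recip p 0<p =
    positive⁻¹ (recip p 0<p) {{1/pos⇒pos p {{positive 0<p}}}}

  recip-anti : ∀ p q (0<p : 0ℚ < p) (0<q : 0ℚ < q) →
    p ≤ q → recip q 0<q ≤ recip p 0<p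
  recip-anti p q 0<p 0<q p≤q = ≤-trans (≤-reflexive eq₁)
    (≤-trans (*-monoʳ P (0<⇒0≤ (0<recip p 0<p)) (*-monoˡ Q (0<⇒0≤ (0<recip q 0<q)) p≤q))
      (≤-reflexive eq₂))
    where
    P = recip p 0<p
    Q = recip q 0<q
    eq₁ : Q ≡ (Q * p) * P
    eq₁ = trans (sym (*-identityʳ Q))
      (trans (cong (Q *_) (sym (*-recip p 0<p))) (sym (*-assoc Q p P)))
    eq₂ : (Q * q) * P ≡ P
    eq₂ = trans (cong (_* P) (trans (*-comm Q q) (*-recip q 0<q))) (*-identityˡ P)

  recip-close : ∀ e p q (0<e : 0ℚ < e) (0<p : 0ℚ < p) (0<q : 0ℚ < q) →
    e ≤ p → e ≤ q →
    ∣ recip p 0<p - recip q 0<q ∣ ≤ (recip e 0<e * recip e 0<e) * ∣ p - q ∣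
  recip-close e p q 0<e 0<p 0<q e≤p e≤q = ≤-trans (≤-reflexive eq)
    (*-monoʳ ∣ p - q ∣ (0≤∣p∣ (p - q))
      (≤-trans (*-monoʳ Q (0<⇒0≤ (0<recip q 0<q)) (recip-anti e p 0<e 0<p e≤p))
        (*-monoˡ E (0<⇒0≤ (0<recip e 0<e)) (recip-anti e q 0<e 0<q e≤q))))
    where
    P = recip p 0<p
    Q = recip q 0<q
    E = recip e 0<e
    expand : P - Q ≡ (P * Q) * (q - p)
    expand = trans
      (cong₂ _-_
        (trans (sym (*-identityʳ P)) (cong (P *_) (sym (*-recip q 0<q))))
        (trans (sym (*-identityʳ Q)) (cong (Q *_) (sym (*-recip p 0<p)))))
      (solve 4 (λ p q P Q → (P :* (q :* Q)) :- (Q :* (p :* P)) := (P :* Q) :* (q :- p))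
        refl p q P Q)
    eq : ∣ P - Q ∣ ≡ (P * Q) * ∣ p - q ∣
    eq = trans (cong ∣_∣ expand)
      (trans (∣p*q∣≡∣p∣*∣q∣ (P * Q) (q - p))
        (cong₂ _*_ (0≤p⇒∣p∣≡p (0<⇒0≤ (0<* (0<recip p 0<p) (0<recip q 0<q))))
          (∣p-q∣≡∣q-p∣ q p)))

open RationalLemmas using (recip)
module L = RationalLemmas

-- The real numbers: Cauchy sequences of rationals.  Two sequences denote the
-- same real when their difference tends to 0 (the relation _≈_ below).

CloseFrom : (ℕ → ℚ) → ℕ → ℚ → Set
CloseFrom x N ε = ∀ m n → N ℕ.≤ m → N ℕ.≤ n → ℚ.∣ x m ℚ.- x n ∣ ℚ.≤ ε

Cauchy : (ℕ → ℚ) → Set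
Cauchy x = ∀ ε → 0ℚ ℚ.< ε → ∃[ N ] CloseFrom x N ε

record ℝ : Set where
  constructor mkℝ
  field
    seq    : ℕ → ℚ
    cauchy : Cauchy seq

open ℝ public

cauchy-slack : ∀ x K → 0ℚ ℚ.< K →
  (∀ δ → 0ℚ ℚ.< δ → ∃[ N ] CloseFrom x N (K ℚ.* δ)) → Cauchy x
cauchy-slack x K 0<K h ε 0<ε with h (recip K 0<K ℚ.* ε) (L.0<* (L.0<recip K 0<K) 0<ε)
... | N , close = N , λ m n N≤m N≤n → ℚ.≤-trans (close m n N≤m N≤n)
  (ℚ.≤-reflexive (trans (sym (ℚ.*-assoc K (recip K 0<K) ε))
    (trans (cong (ℚ._* ε) (L.*-recip K 0<K)) (ℚ.*-identityˡ ε))))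

-- A termwise operation that is 1-Lipschitz for the ℓ¹ distance.
cauchy-lip₂ : (_∙_ : ℚ → ℚ → ℚ) →
  (∀ a b c d → ℚ.∣ (a ∙ b) ℚ.- (c ∙ d) ∣ ℚ.≤ ℚ.∣ a ℚ.- c ∣ ℚ.+ ℚ.∣ b ℚ.- d ∣) →
  ∀ x y → Cauchy x → Cauchy y → Cauchy (λ n → x n ∙ y n)
cauchy-lip₂ _∙_ lip x y cx cy =
  cauchy-slack (λ n → x n ∙ y n) (1ℚ ℚ.+ 1ℚ) (ℚ.positive⁻¹ _) λ δ 0<δ →
    let (M , close-x) = cx δ 0<δ
        (N , close-y) = cy δ 0<δ
    in M ℕ.⊔ N , λ m n ≤m ≤n → ℚ.≤-trans (lip (x m) (y m) (x n) (y n))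
      (ℚ.≤-trans
        (ℚ.+-mono-≤
          (close-x m n (ℕ.m⊔n≤o⇒m≤o M N ≤m) (ℕ.m⊔n≤o⇒m≤o M N ≤n))
          (close-y m n (ℕ.m⊔n≤o⇒n≤o M N ≤m) (ℕ.m⊔n≤o⇒n≤o M N ≤n)))
        (ℚ.≤-reflexive (solve 1 (λ d → d :+ d := (con 1ℚ :+ con 1ℚ) :* d) refl δ)))
  where open +-*-Solver

cauchy-const : ∀ q → Cauchy (λ _ → q)
cauchy-const q ε 0<ε = 0 , λ _ _ _ _ →
  ℚ.≤-trans (ℚ.≤-reflexive (cong ℚ.∣_∣ (ℚ.+-inverseʳ q))) (ℚ.<⇒≤ 0<ε)

cauchy-neg : ∀ x → Cauchy x → Cauchy (λ n → ℚ.- x n)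
cauchy-neg x cx ε 0<ε with cx ε 0<ε
... | N , close = N , λ m n N≤m N≤n → ℚ.≤-trans
  (ℚ.≤-reflexive (trans
    (cong ℚ.∣_∣ (solve 2 (λ a b → (:- a) :- (:- b) := :- (a :- b)) refl (x m) (x n)))
    (ℚ.∣-p∣≡∣p∣ (x m ℚ.- x n))))
  (close m n N≤m N≤n)
  where open +-*-Solver

eventually-bounded : ∀ x → Cauchy x →
  ∃[ B ] (0ℚ ℚ.< B) × (∃[ N ] ∀ n → N ℕ.≤ n → ℚ.∣ x n ∣ ℚ.≤ B)
eventually-bounded x cx with cx 1ℚ (ℚ.positive⁻¹ 1ℚ)
... | N , close = ℚ.∣ x N ∣ ℚ.+ 1ℚ
    , ℚ.+-mono-≤-< (ℚ.0≤∣p∣ (x N)) (ℚ.positive⁻¹ 1ℚ)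
    , N , λ n N≤n → ℚ.≤-trans
        (ℚ.≤-reflexive (cong ℚ.∣_∣ (solve 2 (λ a b → a := b :+ (a :- b)) refl (x n) (x N))))
        (ℚ.≤-trans (ℚ.∣p+q∣≤∣p∣+∣q∣ (x N) (x n ℚ.- x N))
          (ℚ.+-monoʳ-≤ ℚ.∣ x N ∣ (close n N N≤n ℕ.≤-refl)))
  where open +-*-Solver

cauchy-* : ∀ x y → Cauchy x → Cauchy y → Cauchy (λ n → x n ℚ.* y n)
cauchy-* x y cx cy =
  let (A , 0<A , I , bound-x) = eventually-bounded x cx
      (B , 0<B , J , bound-y) = eventually-bounded y cy
  in cauchy-slack (λ n → x n ℚ.* y n) (A ℚ.+ B) (L.0<+ 0<A 0<B) λ δ 0<δ →
    let (M , close-x) = cx δ 0<δ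
        (N , close-y) = cy δ 0<δ
        R = (I ℕ.⊔ J) ℕ.⊔ (M ℕ.⊔ N)
        toIJ : ∀ {n} → R ℕ.≤ n → I ℕ.⊔ J ℕ.≤ n
        toIJ = ℕ.m⊔n≤o⇒m≤o (I ℕ.⊔ J) (M ℕ.⊔ N)
        toMN : ∀ {n} → R ℕ.≤ n → M ℕ.⊔ N ℕ.≤ n
        toMN = ℕ.m⊔n≤o⇒n≤o (I ℕ.⊔ J) (M ℕ.⊔ N)
    in R , λ m n ≤m ≤n → L.∣*∣-close-≤ (x m) (y m) (x n) (y n) A B δ (ℚ.<⇒≤ 0<δ)
      (bound-x m (ℕ.m⊔n≤o⇒m≤o I J (toIJ ≤m)))
      (bound-y n (ℕ.m⊔n≤o⇒n≤o I J (toIJ ≤n)))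
      (close-x m n (ℕ.m⊔n≤o⇒m≤o M N (toMN ≤m)) (ℕ.m⊔n≤o⇒m≤o M N (toMN ≤n)))
      (close-y m n (ℕ.m⊔n≤o⇒n≤o M N (toMN ≤m)) (ℕ.m⊔n≤o⇒n≤o M N (toMN ≤n)))

infix  4 _≤_ _<_ _≈_
infixl 6 _+_ _-_ _⊔_
infixl 7 _*_
infix  8 -_

_≤_ : ℝ → ℝ → Set
x ≤ y = ∀ ε → 0ℚ ℚ.< ε → ∃[ N ] ∀ n → N ℕ.≤ n → seq x n ℚ.≤ seq y n ℚ.+ ε

_<_ : ℝ → ℝ → Set
x < y = ∃[ ε ] (0ℚ ℚ.< ε) × (∃[ N ] ∀ n → N ℕ.≤ n → seq x n ℚ.+ ε ℚ.≤ seq y n)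

_≈_ : ℝ → ℝ → Set
x ≈ y = (x ≤ y) × (y ≤ x)

fromℚ : ℚ → ℝ
fromℚ q = mkℝ (λ _ → q) (cauchy-const q)

0ℝ 1ℝ 2ℝ ½ℝ : ℝ
0ℝ = fromℚ 0ℚ
1ℝ = fromℚ 1ℚ
2ℝ = fromℚ (1ℚ ℚ.+ 1ℚ)
½ℝ = fromℚ ℚ.½

_+_ : ℝ → ℝ → ℝ
x + y = mkℝ (λ n → seq x n ℚ.+ seq y n) (cauchy-lip₂ ℚ._+_ L.∣+∣-close (seq x) (seq y) (cauchy x) (cauchy y))

-_ : ℝ → ℝ
- x = mkℝ (λ n → ℚ.- seq x n) (cauchy-neg (seq x) (cauchy x))

_-_ : ℝ → ℝ → ℝ
x - y = x + (- y)

_*_ : ℝ → ℝ → ℝ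
x * y = mkℝ (λ n → seq x n ℚ.* seq y n) (cauchy-* (seq x) (seq y) (cauchy x) (cauchy y))

_⊔_ : ℝ → ℝ → ℝ
x ⊔ y = mkℝ (λ n → seq x n ℚ.⊔ seq y n) (cauchy-lip₂ ℚ._⊔_ L.∣⊔∣-close (seq x) (seq y) (cauchy x) (cauchy y))

∣_∣ : ℝ → ℝ
∣ x ∣ = x ⊔ (- x)

0<⊔ : ∀ p {ε} → 0ℚ ℚ.< ε → 0ℚ ℚ.< p ℚ.⊔ ε
0<⊔ p {ε} 0<ε = ℚ.<-≤-trans 0<ε (ℚ.p≤q⊔p p ε)

-- If 0 < x is witnessed by ε, then x n ⊔ ε is bounded below by ε and agrees
-- with x n for all large n, so its termwise reciprocal represents 1/x.
recipSeq : ∀ (x : ℕ → ℚ) ε → 0ℚ ℚ.< ε → ℕ → ℚ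
recipSeq x ε 0<ε n = recip (x n ℚ.⊔ ε) (0<⊔ (x n) 0<ε)

cauchy-recip : ∀ x ε (0<ε : 0ℚ ℚ.< ε) → Cauchy x → Cauchy (recipSeq x ε 0<ε)
cauchy-recip x ε 0<ε cx =
  cauchy-slack (recipSeq x ε 0<ε) (E ℚ.* E) (L.0<* 0<E 0<E) λ δ 0<δ →
    let (N , close) = cauchy-lip₂ ℚ._⊔_ L.∣⊔∣-close x (λ _ → ε) cx (cauchy-const ε) δ 0<δ
    in N , λ m n N≤m N≤n → ℚ.≤-trans
      (L.recip-close ε (x m ℚ.⊔ ε) (x n ℚ.⊔ ε) 0<ε (0<⊔ (x m) 0<ε) (0<⊔ (x n) 0<ε)
        (ℚ.p≤q⊔p (x m) ε) (ℚ.p≤q⊔p (x n) ε))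
      (L.*-monoˡ (E ℚ.* E) (ℚ.<⇒≤ (L.0<* 0<E 0<E)) (close m n N≤m N≤n))
  where
  E = recip ε 0<ε
  0<E = L.0<recip ε 0<ε

inverse : (x : ℝ) → 0ℝ < x → ℝ
inverse x (ε , 0<ε , _) = mkℝ (recipSeq (seq x) ε 0<ε) (cauchy-recip (seq x) ε 0<ε (cauchy x))

*-inverse : ∀ x (0<x : 0ℝ < x) → x * inverse x 0<x ≈ 1ℝ
*-inverse x (ε , 0<ε , N , ε≤x) =
    (λ δ 0<δ → N , λ n N≤n → ℚ.≤-trans (ℚ.≤-reflexive (eq n N≤n)) (weaken 0<δ))
  , (λ δ 0<δ → N , λ n N≤n → ℚ.≤-trans (weaken 0<δ)
      (ℚ.≤-reflexive (cong (ℚ._+ δ) (sym (eq n N≤n)))))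
  where
  weaken : ∀ {p δ} → 0ℚ ℚ.< δ → p ℚ.≤ p ℚ.+ δ
  weaken {p} 0<δ = ℚ.≤-trans (ℚ.≤-reflexive (sym (ℚ.+-identityʳ p))) (ℚ.+-monoʳ-≤ p (ℚ.<⇒≤ 0<δ))
  eq : ∀ n → N ℕ.≤ n → seq x n ℚ.* recipSeq (seq x) ε 0<ε n ≡ 1ℚ
  eq n N≤n = trans
    (cong (ℚ._* recipSeq (seq x) ε 0<ε n)
      (sym (ℚ.p≥q⇒p⊔q≡p (ℚ.≤-trans (ℚ.≤-reflexive (sym (ℚ.+-identityˡ ε))) (ε≤x n N≤n)))))
    (L.*-recip (seq x n ℚ.⊔ ε) (0<⊔ (seq x n) 0<ε))

infixl 7 _/_[_]

_/_[_] : (x y : ℝ) → 0ℝ < y → ℝ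
x / y [ 0<y ] = x * inverse y 0<y

_∈[-1,1] : ℝ → Set
x ∈[-1,1] = (- 1ℝ ≤ x) × (x ≤ 1ℝ)

-- ‖ g ‖∞≡ s : the real s is sup { ∣ g x ∣ : x ∈ [-1,1] }, the least upper bound.
-- The supremum norm is a relation because an arbitrary g may have no supremum.
‖_‖∞≡_ : (ℝ → ℝ) → ℝ → Set
‖ g ‖∞≡ s =
    (∀ x → x ∈[-1,1] → ∣ g x ∣ ≤ s)
  × (∀ u → (∀ x → x ∈[-1,1] → ∣ g x ∣ ≤ u) → s ≤ u)

-- Coefficient vector (c₀ , … , c_d) of the polynomial c₀ + c₁ x + … + c_d x^d;
-- leading coefficients may vanish, so this is "degree at most d".
Poly≤ : ℕ → Set
Poly≤ d = Vec ℝ (suc d)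

⟦_⟧ : ∀ {d} → Poly≤ d → ℝ → ℝ
⟦ cs ⟧ x = foldr′ (λ c acc → c + x * acc) 0ℝ cs

-- q ∈ arg min_r ‖ f - r ‖∞ over the real polynomials r of degree at most d.
-- For continuous f all the norms ‖ f - r ‖∞ exist, so this is exactly
-- "‖ f - q ‖∞ ≤ ‖ f - r ‖∞ for every r".
IsℓInfProjection : (d : ℕ) (f : ℝ → ℝ) → Poly≤ d → Set
IsℓInfProjection d f q = ∀ (r : Poly≤ d) s t →
  ‖ (λ x → f x - ⟦ q ⟧ x) ‖∞≡ s → ‖ (λ x → f x - ⟦ r ⟧ x) ‖∞≡ t → s ≤ t

{-# OPTIONS --safe #-}

-- The hinge f vanishes on [-1, 1 - 2α] and rises linearly to 2σ at 1, so f - q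
-- is affine on two pieces and its norm is the largest of the absolute values at
-- -1, b = 1 - 2α and 1.  Comparing q with σ(x + α), whose error equioscillates
-- with amplitude E = σ(1 - α), gives q(b) ≤ E and q(1) ≥ 2σ - E.  Since
-- b = (1 - α)·1 + α·(-1), these force q(-1) ≤ -E, and then
-- σ - q(-1) ≥ σ + E = (2 - α)σ.
module Submission where

open import Defs
open import Data.Product using (∃-syntax; _×_; _,_; proj₁; proj₂)
open import Data.Nat.Base as ℕ using (ℕ)
import Data.Nat.Properties as ℕ
open import Data.Rational.Base as ℚ using (ℚ; 0ℚ; 1ℚ; ½)
import Data.Rational.Properties as ℚ
open import Data.Rational.Solver using (module +-*-Solver)
open import Data.Vec.Base using (_∷_; [])
open import Relation.Binary.Bundles using (Preorder)
open import Relation.Binary.PropositionalEquality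
  using (_≡_; refl; sym; trans; cong; subst)
open import Relation.Nullary using (¬_; yes; no; contradiction)
open +-*-Solver using (solve; con; _:+_; _:*_; _:-_; :-_; _:=_)

-- Order on the reals: nonnegative sums and products.

infix 4 _≼_ _≋_

-- The order of Defs unfolds to a Π-type, from which unification cannot recover
-- the two reals; the record wrapper makes them inferable.  Real arguments are
-- nevertheless often passed explicitly: solving x * y against a product makes
-- Agda compare the normal forms of the Cauchy proofs.
record _≼_ (x y : ℝ) : Set where
  constructor ≤⇒≼
  field ≼⇒≤ : x ≤ y

open _≼_

_≋_ : ℝ → ℝ → Set
x ≋ y = (x ≼ y) × (y ≼ x)

half : ∀ {ε} → 0ℚ ℚ.< ε → 0ℚ ℚ.< ½ ℚ.* ε
half = L.0<* (ℚ.positive⁻¹ ½)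

halves : ∀ ε → ½ ℚ.* ε ℚ.+ ½ ℚ.* ε ≡ ε
halves = solve 1 (λ e → con ½ :* e :+ con ½ :* e := e) refl

private variable
  c u x y z : ℝ

pointwise-≼ : (∀ n → seq x n ℚ.≤ seq y n) → x ≼ y
pointwise-≼ {x} {y} h = ≤⇒≼ λ ε 0<ε → 0 , λ n _ → ℚ.≤-trans
  (ℚ.≤-reflexive (sym (ℚ.+-identityʳ (seq x n))))
  (ℚ.+-mono-≤ (h n) (ℚ.<⇒≤ 0<ε))

pointwise-≋ : (∀ n → seq x n ≡ seq y n) → x ≋ y
pointwise-≋ h =
  pointwise-≼ (λ n → ℚ.≤-reflexive (h n)) , pointwise-≼ (λ n → ℚ.≤-reflexive (sym (h n)))

-- Certificate form of an inequality: a nonnegative real `c` that fills the gap. Ring operations act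
-- termwise on sequences, so the remaining identity is a rational one for the ring solver. Most
-- inequalities below are proved this way.
≼-by : 0ℝ ≼ c → (∀ n → seq x n ℚ.+ seq c n ≡ seq y n) → x ≼ y
≼-by {c} {x} {y} 0≼c eq = ≤⇒≼ λ ε 0<ε →
  let (N , h) = ≼⇒≤ 0≼c ε 0<ε
  in N , λ n N≤n → ℚ.≤-trans
    (ℚ.≤-reflexive (sym (ℚ.+-identityʳ (seq x n))))
    (ℚ.≤-trans (ℚ.+-monoʳ-≤ (seq x n) (h n N≤n))
      (ℚ.≤-reflexive (trans (sym (ℚ.+-assoc (seq x n) (seq c n) ε))
        (cong (ℚ._+ ε) (eq n)))))

diff-nonneg : x ≼ y → 0ℝ ≼ y - x
diff-nonneg {x} {y} x≼y = ≤⇒≼ λ ε 0<ε →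
  let (N , h) = ≼⇒≤ x≼y ε 0<ε
  in N , λ n N≤n → ℚ.≤-trans
    (ℚ.≤-reflexive (sym (ℚ.+-inverseʳ (seq x n))))
    (ℚ.≤-trans (ℚ.+-monoˡ-≤ (ℚ.- seq x n) (h n N≤n))
      (ℚ.≤-reflexive (solve 3 (λ x y e → y :+ e :- x := y :- x :+ e) refl
        (seq x n) (seq y n) ε)))

+-nonneg : 0ℝ ≼ x → 0ℝ ≼ y → 0ℝ ≼ x + y
+-nonneg {x} {y} 0≼x 0≼y = ≤⇒≼ λ ε 0<ε →
  let (M , f) = ≼⇒≤ 0≼x (½ ℚ.* ε) (half 0<ε)
      (N , g) = ≼⇒≤ 0≼y (½ ℚ.* ε) (half 0<ε)
  in M ℕ.⊔ N , λ n ≤n → ℚ.≤-trans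
    (ℚ.+-mono-≤ (f n (ℕ.m⊔n≤o⇒m≤o M N ≤n)) (g n (ℕ.m⊔n≤o⇒n≤o M N ≤n)))
    (ℚ.≤-reflexive (solve 3
      (λ x y e → (x :+ con ½ :* e) :+ (y :+ con ½ :* e) := x :+ y :+ e) refl
      (seq x n) (seq y n) ε))

-- Truncating both factors at 0 moves each by at most δ, hence the product by
-- at most (A + B)δ.
*-nonneg-approx : ∀ p q A B δ → 0ℚ ℚ.≤ δ → ℚ.∣ p ∣ ℚ.≤ A → ℚ.∣ q ∣ ℚ.≤ B →
  0ℚ ℚ.≤ p ℚ.+ δ → 0ℚ ℚ.≤ q ℚ.+ δ → 0ℚ ℚ.≤ p ℚ.* q ℚ.+ (A ℚ.+ B) ℚ.* δ
*-nonneg-approx p q A B δ 0≤δ ∣p∣≤A ∣q∣≤B 0≤p+δ 0≤q+δ = ℚ.≤-trans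
  (ℚ.≤-trans (ℚ.≤-reflexive (sym (ℚ.*-zeroʳ p⁺)))
    (L.*-monoˡ p⁺ (ℚ.p≤q⊔p p 0ℚ) (ℚ.p≤q⊔p q 0ℚ)))
  (ℚ.≤-trans (L.p≤q+∣p-q∣ (p⁺ ℚ.* q⁺) (p ℚ.* q))
    (ℚ.+-monoʳ-≤ (p ℚ.* q) (ℚ.≤-trans
      (ℚ.≤-reflexive (L.∣p-q∣≡∣q-p∣ (p⁺ ℚ.* q⁺) (p ℚ.* q)))
      (L.∣*∣-close-≤ p q p⁺ q⁺ A B δ 0≤δ ∣p∣≤A ∣q⁺∣≤B
        (truncation p 0≤p+δ) (truncation q 0≤q+δ)))))
  where
  p⁺ = p ℚ.⊔ 0ℚ
  q⁺ = q ℚ.⊔ 0ℚ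
  ∣q⁺∣≤B : ℚ.∣ q⁺ ∣ ℚ.≤ B
  ∣q⁺∣≤B = ℚ.≤-trans (ℚ.≤-reflexive (ℚ.0≤p⇒∣p∣≡p (ℚ.p≤q⊔p q 0ℚ)))
    (ℚ.≤-trans (ℚ.⊔-lub (L.p≤∣p∣ q) (ℚ.0≤∣p∣ q)) ∣q∣≤B)
  ≤+δ : ∀ r → r ℚ.≤ r ℚ.+ δ
  ≤+δ r = ℚ.≤-trans (ℚ.≤-reflexive (sym (ℚ.+-identityʳ r))) (ℚ.+-monoʳ-≤ r 0≤δ)
  truncation : ∀ r → 0ℚ ℚ.≤ r ℚ.+ δ → ℚ.∣ r ℚ.- (r ℚ.⊔ 0ℚ) ∣ ℚ.≤ δ
  truncation r 0≤r+δ = L.∣-∣-lub r (r ℚ.⊔ 0ℚ) δ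
    (ℚ.≤-trans (ℚ.p≤p⊔q r 0ℚ) (≤+δ (r ℚ.⊔ 0ℚ)))
    (ℚ.⊔-lub (≤+δ r) 0≤r+δ)

*-nonneg : 0ℝ ≼ x → 0ℝ ≼ y → 0ℝ ≼ x * y
*-nonneg {x} {y} 0≼x 0≼y = ≤⇒≼ λ ε 0<ε →
  let (A , 0<A , I , bound-x) = eventually-bounded (seq x) (cauchy x)
      (B , 0<B , J , bound-y) = eventually-bounded (seq y) (cauchy y)
      0<A+B = L.0<+ 0<A 0<B
      -- The product can fall below 0 by at most (A + B)δ, so δ = ε / (A + B) makes the loss exactly
      -- ε.
      δ   = L.recip (A ℚ.+ B) 0<A+B ℚ.* ε
      0<δ = L.0<* (L.0<recip (A ℚ.+ B) 0<A+B) 0<ε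
      (M , f) = ≼⇒≤ 0≼x δ 0<δ
      (N , g) = ≼⇒≤ 0≼y δ 0<δ
      slack : (A ℚ.+ B) ℚ.* δ ≡ ε
      slack = trans (sym (ℚ.*-assoc (A ℚ.+ B) _ ε))
        (trans (cong (ℚ._* ε) (L.*-recip (A ℚ.+ B) 0<A+B)) (ℚ.*-identityˡ ε))
  in (I ℕ.⊔ J) ℕ.⊔ (M ℕ.⊔ N) , λ n ≤n →
    let ≤IJ = ℕ.m⊔n≤o⇒m≤o (I ℕ.⊔ J) (M ℕ.⊔ N) ≤n
        ≤MN = ℕ.m⊔n≤o⇒n≤o (I ℕ.⊔ J) (M ℕ.⊔ N) ≤n
    in subst (λ e → 0ℚ ℚ.≤ seq x n ℚ.* seq y n ℚ.+ e) slack
      (*-nonneg-approx (seq x n) (seq y n) A B δ (ℚ.<⇒≤ 0<δ)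
        (bound-x n (ℕ.m⊔n≤o⇒m≤o I J ≤IJ)) (bound-y n (ℕ.m⊔n≤o⇒n≤o I J ≤IJ))
        (f n (ℕ.m⊔n≤o⇒m≤o M N ≤MN)) (g n (ℕ.m⊔n≤o⇒n≤o M N ≤MN)))

-- Preorder reasoning, monotonicity and maxima.

≼-refl : x ≼ x
≼-refl = proj₁ (pointwise-≋ λ _ → refl)

≼-trans : x ≼ y → y ≼ z → x ≼ z
≼-trans {x} {y} {z} x≼y y≼z = ≼-by (+-nonneg (diff-nonneg x≼y) (diff-nonneg y≼z))
  λ n → solve 3 (λ x y z → x :+ ((y :- x) :+ (z :- y)) := z) refl (seq x n) (seq y n) (seq z n)

≋-sym : x ≋ y → y ≋ x
≋-sym (x≼y , y≼x) = y≼x , x≼y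

≋-trans : x ≋ y → y ≋ z → x ≋ z
≋-trans (x≼y , y≼x) (y≼z , z≼y) = ≼-trans x≼y y≼z , ≼-trans z≼y y≼x

≼-preorder : Preorder _ _ _
≼-preorder = record
  { Carrier = ℝ
  ; _≈_ = _≋_
  ; _≲_ = _≼_
  ; isPreorder = record
    { isEquivalence = record { refl = ≼-refl , ≼-refl ; sym = ≋-sym ; trans = ≋-trans }
    ; reflexive = proj₁
    ; trans = ≼-trans
    }
  }

open import Relation.Binary.Reasoning.Preorder ≼-preorder

+-monoˡ-≼ : ∀ x y z → x ≼ y → x + z ≼ y + z
+-monoˡ-≼ x y z x≼y = ≼-by (diff-nonneg x≼y)
  λ n → solve 3 (λ x y z → (x :+ z) :+ (y :- x) := y :+ z) refl (seq x n) (seq y n) (seq z n)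

-‿anti-≼ : ∀ x y → x ≼ y → - y ≼ - x
-‿anti-≼ x y x≼y = ≼-by (diff-nonneg x≼y)
  λ n → solve 2 (λ x y → (:- y) :+ (y :- x) := :- x) refl (seq x n) (seq y n)

*-monoˡ-≼ : ∀ z x y → 0ℝ ≼ z → x ≼ y → z * x ≼ z * y
*-monoˡ-≼ z x y 0≼z x≼y = ≼-by (*-nonneg 0≼z (diff-nonneg x≼y))
  λ n → solve 3 (λ x y z → z :* x :+ z :* (y :- x) := z :* y) refl (seq x n) (seq y n) (seq z n)

+-congʳ-≋ : ∀ x y z → x ≋ y → x + z ≋ y + z
+-congʳ-≋ x y z (x≼y , y≼x) = +-monoˡ-≼ x y z x≼y , +-monoˡ-≼ y x z y≼x

-‿cong-≋ : ∀ x y → x ≋ y → - x ≋ - y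
-‿cong-≋ x y (x≼y , y≼x) = -‿anti-≼ y x y≼x , -‿anti-≼ x y x≼y

x≼x⊔y : x ≼ x ⊔ y
x≼x⊔y {x} {y} = pointwise-≼ λ n → ℚ.p≤p⊔q (seq x n) (seq y n)

y≼x⊔y : y ≼ x ⊔ y
y≼x⊔y {y} {x} = pointwise-≼ λ n → ℚ.p≤q⊔p (seq x n) (seq y n)

⊔-lub : x ≼ z → y ≼ z → x ⊔ y ≼ z
⊔-lub x≼z y≼z = ≤⇒≼ λ ε 0<ε →
  let (M , f) = ≼⇒≤ x≼z ε 0<ε
      (N , g) = ≼⇒≤ y≼z ε 0<ε
  in M ℕ.⊔ N , λ n ≤n →
    ℚ.⊔-lub (f n (ℕ.m⊔n≤o⇒m≤o M N ≤n)) (g n (ℕ.m⊔n≤o⇒n≤o M N ≤n))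

-- The second factor has no sign, so it is split as (y ⊔ 0) - ((y ⊔ 0) - y).
*-congʳ-≋ : ∀ x x′ y → x ≋ x′ → x * y ≋ x′ * y
*-congʳ-≋ x x′ y (x≼x′ , x′≼x) = mono x x′ x≼x′ x′≼x , mono x′ x x′≼x x≼x′
  where
  mono : ∀ u z → u ≼ z → z ≼ u → u * y ≼ z * y
  mono u z u≼z z≼u = ≼-by
    (+-nonneg (*-nonneg (diff-nonneg u≼z) (y≼x⊔y {0ℝ} {y}))
              (*-nonneg (diff-nonneg z≼u) (diff-nonneg (x≼x⊔y {y} {0ℝ}))))
    λ n → solve 4
      (λ u z y t → u :* y :+ ((z :- u) :* t :+ (u :- z) :* (t :- y)) := z :* y) refl
      (seq u n) (seq z n) (seq y n) (seq y n ℚ.⊔ 0ℚ)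

*-congˡ-≋ : ∀ z x y → 0ℝ ≼ z → x ≋ y → z * x ≋ z * y
*-congˡ-≋ z x y 0≼z (x≼y , y≼x) = *-monoˡ-≼ z x y 0≼z x≼y , *-monoˡ-≼ z y x 0≼z y≼x

-- Strict order and proof by cases.

<⇒≼ : x < y → x ≼ y
<⇒≼ {x} {y} (ε , 0<ε , N , h) = ≤⇒≼ λ δ 0<δ → N , λ n N≤n → ℚ.≤-trans
  (ℚ.≤-trans (≤+ (seq x n) 0<ε) (h n N≤n)) (≤+ (seq y n) 0<δ)
  where
  ≤+ : ∀ p {ε} → 0ℚ ℚ.< ε → p ℚ.≤ p ℚ.+ ε
  ≤+ p 0<ε = ℚ.≤-trans (ℚ.≤-reflexive (sym (ℚ.+-identityʳ p))) (ℚ.+-monoʳ-≤ p (ℚ.<⇒≤ 0<ε))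

<⇒⋠ : x < y → ¬ y ≼ x
-- With tolerance ε/2 against a gap of ε, the term at index `M ⊔ N` would satisfy x + ε ≤ x + ε/2.
<⇒⋠ {x} {y} (ε , 0<ε , M , f) y≼x with ≼⇒≤ y≼x (½ ℚ.* ε) (half 0<ε)
... | N , g = ℚ.<-irrefl refl (ℚ.<-≤-trans
    (ℚ.<-≤-trans (ℚ.+-monoʳ-< p (half 0<ε)) (ℚ.≤-reflexive eq))
    (ℚ.≤-trans (f n (ℕ.m≤m⊔n M N)) (ℚ.≤-trans (g n (ℕ.m≤n⊔m M N))
      (ℚ.≤-reflexive (sym (ℚ.+-identityʳ p))))))
  where
  n = M ℕ.⊔ N
  p = seq x n ℚ.+ ½ ℚ.* ε
  eq : p ℚ.+ ½ ℚ.* ε ≡ seq x n ℚ.+ ε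
  eq = trans (ℚ.+-assoc (seq x n) (½ ℚ.* ε) (½ ℚ.* ε)) (cong (seq x n ℚ.+_) (halves ε))

-- Only rationals are compared. Past some N the difference d = x - y varies by at most η = ε/2. If d
-- N ≤ η, then d n ≤ 2η = ε from N on; otherwise d n stays above the positive rational d N - η,
-- which witnesses the excluded `y < x`.
≮⇒≽ : ¬ (y < x) → x ≼ y
≮⇒≽ {y} {x} y≮x = ≤⇒≼ λ ε 0<ε →
  approx (½ ℚ.* ε) (halves ε) (cauchy (x - y) (½ ℚ.* ε) (half 0<ε))
  where
  d : ℕ → ℚ
  d n = seq x n ℚ.- seq y n
  y+d≡x : ∀ n → seq y n ℚ.+ d n ≡ seq x n
  y+d≡x n = solve 2 (λ x y → y :+ (x :- y) := x) refl (seq x n) (seq y n)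
  approx : ∀ {ε} η → η ℚ.+ η ≡ ε → ∃[ N ] CloseFrom d N η →
    ∃[ N ] ∀ n → N ℕ.≤ n → seq x n ℚ.≤ seq y n ℚ.+ ε
  approx {ε} η η+η≡ε (N , close) with d N ℚ.≤? η
  ... | yes dN≤η = N , λ n N≤n → subst (ℚ._≤ seq y n ℚ.+ ε) (y+d≡x n)
    (ℚ.+-monoʳ-≤ (seq y n) (ℚ.≤-trans (L.p≤q+∣p-q∣ (d n) (d N))
      (ℚ.≤-trans (ℚ.+-mono-≤ dN≤η (close n N N≤n ℕ.≤-refl)) (ℚ.≤-reflexive η+η≡ε))))
  ... | no  dN≰η = contradiction (d N ℚ.- η , 0<gap , N , below) y≮x
    where
    0<gap : 0ℚ ℚ.< d N ℚ.- η
    0<gap = subst (ℚ._< d N ℚ.- η) (ℚ.+-inverseʳ η) (ℚ.+-monoˡ-< (ℚ.- η) (ℚ.≰⇒> dN≰η))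
    below : ∀ n → N ℕ.≤ n → seq y n ℚ.+ (d N ℚ.- η) ℚ.≤ seq x n
    below n N≤n = subst (seq y n ℚ.+ (d N ℚ.- η) ℚ.≤_) (y+d≡x n)
      (ℚ.+-monoʳ-≤ (seq y n) (L.p≤q+r⇒p-q≤r (d N) η (d n)
        (ℚ.≤-trans (L.p≤q+∣p-q∣ (d N) (d n))
          (ℚ.≤-trans (ℚ.+-monoʳ-≤ (d n) (close N n ℕ.≤-refl N≤n))
            (ℚ.≤-reflexive (ℚ.+-comm (d n) η))))))

-- The order is not decidable, but an inequality may be proved by cases on x ≼ y
-- because ≼ is stable under double negation.
≼-cases : ∀ x y → (x ≼ y → u ≼ z) → (y ≼ x → u ≼ z) → u ≼ z
≼-cases x y f g = ≮⇒≽ λ z<u →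
  <⇒⋠ z<u (f (≮⇒≽ λ y<x → <⇒⋠ z<u (g (<⇒≼ y<x))))

-- Inverses and quotients.

0≼inverse : ∀ x (0<x : 0ℝ < x) → 0ℝ ≼ inverse x 0<x
0≼inverse x (ε , 0<ε , _) = pointwise-≼ λ n →
  ℚ.<⇒≤ (L.0<recip (seq x n ℚ.⊔ ε) (0<⊔ (seq x n) 0<ε))

*-inverse-≋ : ∀ x (0<x : 0ℝ < x) → x * inverse x 0<x ≋ 1ℝ
*-inverse-≋ x 0<x = ≤⇒≼ (proj₁ (*-inverse x 0<x)) , ≤⇒≼ (proj₂ (*-inverse x 0<x))

/-nonneg : ∀ x y → 0ℝ ≼ x → (0<y : 0ℝ < y) → 0ℝ ≼ x / y [ 0<y ]
/-nonneg x y 0≼x 0<y = ≼-trans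
  (*-nonneg {x} {inverse y 0<y} 0≼x (0≼inverse y 0<y))
  (pointwise-≼ λ _ → ℚ.≤-refl)

/-cancel : ∀ x y (0<y : 0ℝ < y) → (x / y [ 0<y ]) * y ≋ x
/-cancel x y 0<y = begin-equality
  (x / y [ 0<y ]) * y
    ≈⟨ pointwise-≋ (λ n → solve 3 (λ x y i → (x :* i) :* y := (y :* i) :* x) refl
         (seq x n) (seq y n) (seq (inverse y 0<y) n)) ⟩
  (y * inverse y 0<y) * x
    ≈⟨ *-congʳ-≋ (y * inverse y 0<y) 1ℝ x (*-inverse-≋ y 0<y) ⟩
  1ℝ * x
    ≈⟨ pointwise-≋ (λ n → ℚ.*-identityˡ (seq x n)) ⟩
  x ∎

-- Absolute values and affine functions on an interval.

to-≤ : ∀ x y → x ≼ y → x ≤ y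
to-≤ x y = ≼⇒≤

∣∣-lub : ∀ x → x ≼ u → - x ≼ u → ∣ x ∣ ≼ u
∣∣-lub {u} x = ⊔-lub {x} {u} { - x}

x≼∣x∣ : ∀ x → x ≼ ∣ x ∣
x≼∣x∣ x = x≼x⊔y {x} { - x}

-x≼∣x∣ : ∀ x → - x ≼ ∣ x ∣
-x≼∣x∣ x = y≼x⊔y { - x} {x}

∣∣≼-resp-≋ : ∀ x y → x ≋ y → y ≼ u → - y ≼ u → ∣ x ∣ ≼ u
∣∣≼-resp-≋ x y (x≼y , y≼x) y≼u -y≼u =
  ∣∣-lub x (≼-trans x≼y y≼u) (≼-trans (-‿anti-≼ y x y≼x) -y≼u)

module _ (a c x : ℝ) {u : ℝ} (a≼x : a ≼ x) (x≼c : x ≼ c) where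

  -- An affine function is monotone, so its larger endpoint value dominates: the right one if the
  -- slope is nonnegative, the left one otherwise. The sign of the slope is undecidable, hence
  -- `≼-cases`.
  affine-≼ : ∀ c₀ c₁ → c₀ + c₁ * a ≼ u → c₀ + c₁ * c ≼ u → c₀ + c₁ * x ≼ u
  affine-≼ c₀ c₁ at-a at-c = ≼-cases 0ℝ c₁
    (λ 0≼c₁ → ≼-trans
      (≼-by (*-nonneg 0≼c₁ (diff-nonneg x≼c)) λ n → solve 4
        (λ d e x c → (d :+ e :* x) :+ e :* (c :- x) := d :+ e :* c) refl
        (seq c₀ n) (seq c₁ n) (seq x n) (seq c n))
      at-c)
    (λ c₁≼0 → ≼-trans
      (≼-by (*-nonneg (diff-nonneg c₁≼0) (diff-nonneg a≼x)) λ n → solve 4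
        (λ d e x a → (d :+ e :* x) :+ (con 0ℚ :- e) :* (x :- a) := d :+ e :* a) refl
        (seq c₀ n) (seq c₁ n) (seq x n) (seq a n))
      at-a)

  affine-on-≼ : ∀ (g : ℝ → ℝ) c₀ c₁ → (∀ t → a ≼ t → t ≼ c → g t ≋ c₀ + c₁ * t) →
    g a ≼ u → g c ≼ u → g x ≼ u
  affine-on-≼ g c₀ c₁ affine at-a at-c = ≼-trans (proj₁ (affine x a≼x x≼c))
    (affine-≼ c₀ c₁
      (≼-trans (proj₂ (affine a ≼-refl (≼-trans a≼x x≼c))) at-a)
      (≼-trans (proj₂ (affine c (≼-trans a≼x x≼c) ≼-refl)) at-c))

  -- The one-sided bound is applied to both `g` and its negative, which is affine with negated
  -- coefficients.
  affine-on-∣∣≼ : ∀ (g : ℝ → ℝ) c₀ c₁ → (∀ t → a ≼ t → t ≼ c → g t ≋ c₀ + c₁ * t) →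
    ∣ g a ∣ ≼ u → ∣ g c ∣ ≼ u → ∣ g x ∣ ≼ u
  affine-on-∣∣≼ g c₀ c₁ affine at-a at-c = ∣∣-lub (g x)
    (affine-on-≼ g c₀ c₁ affine (≼-trans (x≼∣x∣ (g a)) at-a) (≼-trans (x≼∣x∣ (g c)) at-c))
    (affine-on-≼ (λ t → - g t) (- c₀) (- c₁) neg-affine
      (≼-trans (-x≼∣x∣ (g a)) at-a) (≼-trans (-x≼∣x∣ (g c)) at-c))
    where
    neg-affine : ∀ t → a ≼ t → t ≼ c → - g t ≋ - c₀ + (- c₁) * t
    neg-affine t a≼t t≼c = ≋-trans
      (-‿cong-≋ (g t) (c₀ + c₁ * t) (affine t a≼t t≼c))
      (pointwise-≋ λ n → solve 3 (λ d e t → :- (d :+ e :* t) := (:- d) :+ (:- e) :* t) refl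
        (seq c₀ n) (seq c₁ n) (seq t n))

-- Supremum norms of affine and piecewise affine functions.

-1≼1 : - 1ℝ ≼ 1ℝ
-1≼1 = pointwise-≼ λ _ → ℚ.≤-trans (ℚ.nonPositive⁻¹ (ℚ.- 1ℚ)) (ℚ.nonNegative⁻¹ 1ℚ)

0≼2 : 0ℝ ≼ 2ℝ
0≼2 = pointwise-≼ λ _ → ℚ.nonNegative⁻¹ (1ℚ ℚ.+ 1ℚ)

-1∈ : (- 1ℝ) ∈[-1,1]
-1∈ = to-≤ (- 1ℝ) (- 1ℝ) ≼-refl , to-≤ (- 1ℝ) 1ℝ -1≼1

1∈ : 1ℝ ∈[-1,1]
1∈ = to-≤ (- 1ℝ) 1ℝ -1≼1 , to-≤ 1ℝ 1ℝ ≼-refl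

norm-affine : ∀ (g : ℝ → ℝ) c₀ c₁ →
  (∀ t → - 1ℝ ≼ t → t ≼ 1ℝ → g t ≋ c₀ + c₁ * t) →
  ‖ g ‖∞≡ (∣ g (- 1ℝ) ∣ ⊔ ∣ g 1ℝ ∣)
norm-affine g c₀ c₁ affine =
    (λ x (-1≤x , x≤1) → to-≤ ∣ g x ∣ (∣ g (- 1ℝ) ∣ ⊔ ∣ g 1ℝ ∣)
      (affine-on-∣∣≼ (- 1ℝ) 1ℝ x (≤⇒≼ -1≤x) (≤⇒≼ x≤1) g c₀ c₁ affine
        (x≼x⊔y {∣ g (- 1ℝ) ∣} {∣ g 1ℝ ∣}) (y≼x⊔y {∣ g 1ℝ ∣} {∣ g (- 1ℝ) ∣})))
  , (λ u h → to-≤ (∣ g (- 1ℝ) ∣ ⊔ ∣ g 1ℝ ∣) u (⊔-lub {∣ g (- 1ℝ) ∣} {u} {∣ g 1ℝ ∣}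
      (≤⇒≼ (h (- 1ℝ) -1∈)) (≤⇒≼ (h 1ℝ 1∈))))

-- The norm is the largest absolute value at the three nodes. The last component lets a norm be
-- bounded later by evaluating at these nodes alone.
norm-piecewise-affine : ∀ (g : ℝ → ℝ) b → - 1ℝ ≼ b → b ≼ 1ℝ → ∀ c₀ c₁ d₀ d₁ →
  (∀ t → - 1ℝ ≼ t → t ≼ b → g t ≋ c₀ + c₁ * t) →
  (∀ t → b ≼ t → t ≼ 1ℝ → g t ≋ d₀ + d₁ * t) →
  ∃[ s ] ‖ g ‖∞≡ s
       × (∀ u → ∣ g (- 1ℝ) ∣ ≼ u → ∣ g b ∣ ≼ u → ∣ g 1ℝ ∣ ≼ u → s ≼ u)
norm-piecewise-affine g b -1≼b b≼1 c₀ c₁ d₀ d₁ left right =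
    L ⊔ B ⊔ R
  , ( (λ x (-1≤x , x≤1) → to-≤ ∣ g x ∣ (L ⊔ B ⊔ R) (≼-cases x b
        (λ x≼b → affine-on-∣∣≼ (- 1ℝ) b x (≤⇒≼ -1≤x) x≼b g c₀ c₁ left L≼M B≼M)
        (λ b≼x → affine-on-∣∣≼ b 1ℝ x b≼x (≤⇒≼ x≤1) g d₀ d₁ right B≼M R≼M)))
    , (λ u h → to-≤ (L ⊔ B ⊔ R) u (least u
        (≤⇒≼ (h (- 1ℝ) -1∈))
        (≤⇒≼ (h b (to-≤ (- 1ℝ) b -1≼b , to-≤ b 1ℝ b≼1)))
        (≤⇒≼ (h 1ℝ 1∈)))))
  , least
  where
  L = ∣ g (- 1ℝ) ∣
  B = ∣ g b ∣
  R = ∣ g 1ℝ ∣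
  least : ∀ u → L ≼ u → B ≼ u → R ≼ u → L ⊔ B ⊔ R ≼ u
  least u L≼u B≼u R≼u = ⊔-lub {L ⊔ B} {u} {R} (⊔-lub {L} {u} {B} L≼u B≼u) R≼u
  L≼M : L ≼ L ⊔ B ⊔ R
  L≼M = ≼-trans (x≼x⊔y {L} {B}) (x≼x⊔y {L ⊔ B} {R})
  B≼M : B ≼ L ⊔ B ⊔ R
  B≼M = ≼-trans (y≼x⊔y {B} {L}) (x≼x⊔y {L ⊔ B} {R})
  R≼M : R ≼ L ⊔ B ⊔ R
  R≼M = y≼x⊔y {R} {L ⊔ B}

-- The two branches of the hinge.

module _ (k b x : ℝ) (0≼k : 0ℝ ≼ k) where

  hinge-nonneg : 0ℝ ≼ k * (0ℝ ⊔ (x - b))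
  hinge-nonneg = *-nonneg {k} {0ℝ ⊔ (x - b)} 0≼k (x≼x⊔y {0ℝ} {x - b})

  hinge-left : x ≼ b → k * (0ℝ ⊔ (x - b)) ≋ 0ℝ
  hinge-left x≼b = ≋-trans
    (*-congˡ-≋ k (0ℝ ⊔ (x - b)) 0ℝ 0≼k
      ( ⊔-lub {0ℝ} {0ℝ} {x - b} ≼-refl (≼-by (diff-nonneg {x} {b} x≼b) λ n →
          solve 2 (λ x b → (x :- b) :+ (b :- x) := con 0ℚ) refl (seq x n) (seq b n))
      , x≼x⊔y {0ℝ} {x - b}))
    (pointwise-≋ λ n → ℚ.*-zeroʳ (seq k n))

  hinge-right : b ≼ x → k * (0ℝ ⊔ (x - b)) ≋ k * (x - b)
  hinge-right b≼x = *-congˡ-≋ k (0ℝ ⊔ (x - b)) (x - b) 0≼k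
    ( ⊔-lub {0ℝ} {x - b} {x - b} (diff-nonneg {b} {x} b≼x) ≼-refl
    , y≼x⊔y {x - b} {0ℝ})

-- Differences with a line and their norms.

const-minus-line-norm : ∀ σ c₀ c₁ → ∃[ s ] ‖ (λ x → σ - ⟦ c₀ ∷ c₁ ∷ [] ⟧ x) ‖∞≡ s
const-minus-line-norm σ c₀ c₁ =
  ∣ σ - ⟦ c₀ ∷ c₁ ∷ [] ⟧ (- 1ℝ) ∣ ⊔ ∣ σ - ⟦ c₀ ∷ c₁ ∷ [] ⟧ 1ℝ ∣ ,
  norm-affine (λ x → σ - ⟦ c₀ ∷ c₁ ∷ [] ⟧ x) (σ - c₀) (- c₁)
    λ x _ _ → pointwise-≋ λ n → solve 4
      (λ s d e x → s :- (d :+ x :* (e :+ x :* con 0ℚ)) := (s :- d) :+ (:- e) :* x) refl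
      (seq σ n) (seq c₀ n) (seq c₁ n) (seq x n)

-- `f` stays abstract and enters only through its two affine branches, so the solver identities
-- contain no maximum.
module Residual (f : ℝ → ℝ) (k b : ℝ)
  (f-left : ∀ x → x ≼ b → f x ≋ 0ℝ) (f-right : ∀ x → b ≼ x → f x ≋ k * (x - b))
  where

  residual-left : ∀ c₀ c₁ x → x ≼ b → f x - ⟦ c₀ ∷ c₁ ∷ [] ⟧ x ≋ - c₀ + (- c₁) * x
  residual-left c₀ c₁ x x≼b = ≋-trans
    (+-congʳ-≋ (f x) 0ℝ (- ⟦ c₀ ∷ c₁ ∷ [] ⟧ x) (f-left x x≼b))
    (pointwise-≋ λ n → solve 3
      (λ d e x → con 0ℚ :- (d :+ x :* (e :+ x :* con 0ℚ)) := (:- d) :+ (:- e) :* x) refl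
      (seq c₀ n) (seq c₁ n) (seq x n))

  residual-right : ∀ c₀ c₁ x → b ≼ x →
    f x - ⟦ c₀ ∷ c₁ ∷ [] ⟧ x ≋ (- (k * b) - c₀) + (k - c₁) * x
  residual-right c₀ c₁ x b≼x = ≋-trans
    (+-congʳ-≋ (f x) (k * (x - b)) (- ⟦ c₀ ∷ c₁ ∷ [] ⟧ x) (f-right x b≼x))
    (pointwise-≋ λ n → solve 5
      (λ k b d e x → k :* (x :- b) :- (d :+ x :* (e :+ x :* con 0ℚ))
        := ((:- (k :* b)) :- d) :+ (k :- e) :* x) refl
      (seq k n) (seq b n) (seq c₀ n) (seq c₁ n) (seq x n))

  residual-norm : ∀ c₀ c₁ → - 1ℝ ≼ b → b ≼ 1ℝ →
    ∃[ s ] ‖ (λ x → f x - ⟦ c₀ ∷ c₁ ∷ [] ⟧ x) ‖∞≡ s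
         × (∀ u → ∣ f (- 1ℝ) - ⟦ c₀ ∷ c₁ ∷ [] ⟧ (- 1ℝ) ∣ ≼ u →
              ∣ f b - ⟦ c₀ ∷ c₁ ∷ [] ⟧ b ∣ ≼ u → ∣ f 1ℝ - ⟦ c₀ ∷ c₁ ∷ [] ⟧ 1ℝ ∣ ≼ u → s ≼ u)
  residual-norm c₀ c₁ -1≼b b≼1 =
    norm-piecewise-affine (λ x → f x - ⟦ c₀ ∷ c₁ ∷ [] ⟧ x) b -1≼b b≼1
      (- c₀) (- c₁) (- (k * b) - c₀) (k - c₁)
      (λ x _ x≼b → residual-left c₀ c₁ x x≼b) (λ x b≼x _ → residual-right c₀ c₁ x b≼x)

-- Multiplying by the nonnegative inverse of `x` undoes the factor; this later divides an inequality
-- by α.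
*-cancelˡ-nonneg : ∀ x y → 0ℝ < x → 0ℝ ≼ x * y → 0ℝ ≼ y
*-cancelˡ-nonneg x y 0<x 0≼xy = begin
  0ℝ
    ≲⟨ *-nonneg {inverse x 0<x} {x * y} (0≼inverse x 0<x) 0≼xy ⟩
  inverse x 0<x * (x * y)
    ≈⟨ pointwise-≋ (λ n → solve 3 (λ i x y → i :* (x :* y) := (x :* i) :* y) refl
         (seq (inverse x 0<x) n) (seq x n) (seq y n)) ⟩
  (x * inverse x 0<x) * y
    ≈⟨ *-congʳ-≋ (x * inverse x 0<x) 1ℝ y (*-inverse-≋ x 0<x) ⟩
  1ℝ * y
    ≈⟨ pointwise-≋ (λ n → ℚ.*-identityˡ (seq y n)) ⟩
  y ∎

-- The breakpoint 1 - 2α and the distance from the constant to the hinge.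

module Breakpoint (α : ℝ) (0<α : 0ℝ < α) (α<½ : α < ½ℝ) where

  0≼α : 0ℝ ≼ α
  0≼α = <⇒≼ {0ℝ} {α} 0<α

  0≼1-α : 0ℝ ≼ 1ℝ - α
  0≼1-α = ≼-by (+-nonneg (diff-nonneg (<⇒≼ {α} {½ℝ} α<½)) 0≼½) λ n →
    solve 1 (λ a → con 0ℚ :+ ((con ½ :- a) :+ con ½) := con 1ℚ :- a) refl (seq α n)
    where
    0≼½ : 0ℝ ≼ ½ℝ
    0≼½ = pointwise-≼ λ _ → ℚ.nonNegative⁻¹ ½

  -1≼b : - 1ℝ ≼ 1ℝ - 2ℝ * α
  -1≼b = ≼-by (*-nonneg 0≼2 0≼1-α) λ n →
    solve 1 (λ a → con (ℚ.- 1ℚ) :+ con (1ℚ ℚ.+ 1ℚ) :* (con 1ℚ :- a)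
      := con 1ℚ :- con (1ℚ ℚ.+ 1ℚ) :* a) refl (seq α n)

  b≼1 : 1ℝ - 2ℝ * α ≼ 1ℝ
  b≼1 = ≼-by (*-nonneg 0≼2 0≼α) λ n →
    solve 1 (λ a → (con 1ℚ :- con (1ℚ ℚ.+ 1ℚ) :* a) :+ con (1ℚ ℚ.+ 1ℚ) :* a := con 1ℚ)
      refl (seq α n)

-- `k` stands for σ/α and is known only by its sign and by kα = σ, which keeps inverses out of the
-- ring identities.
module Hinge (σ α k : ℝ) (0≼σ : 0ℝ ≼ σ) (0<α : 0ℝ < α) (α<½ : α < ½ℝ)
  (0≼k : 0ℝ ≼ k) (kα≋σ : k * α ≋ σ) where

  open Breakpoint α 0<α α<½

  -- σ(x + 1) is the chord of the convex hinge from (-1, 0) to (1, 2σ). After factoring out `k`,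
  -- both entries of the maximum lie below α(x + 1); for the sloped one the gap is (1 - α)(1 - x).
  hinge-≼-chord : ∀ x → - 1ℝ ≼ x → x ≼ 1ℝ →
    k * (0ℝ ⊔ (x - (1ℝ - 2ℝ * α))) ≼ σ * (x - - 1ℝ)
  hinge-≼-chord x -1≼x x≼1 = begin
    k * (0ℝ ⊔ (x - (1ℝ - 2ℝ * α)))
      ≲⟨ *-monoˡ-≼ k (0ℝ ⊔ (x - (1ℝ - 2ℝ * α))) (α * (x - - 1ℝ)) 0≼k
           (⊔-lub {0ℝ} {α * (x - - 1ℝ)} {x - (1ℝ - 2ℝ * α)}
             (*-nonneg {α} {x - - 1ℝ} 0≼α (diff-nonneg { - 1ℝ} {x} -1≼x))
             (≼-by (*-nonneg 0≼1-α (diff-nonneg x≼1)) λ n → solve 2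
               (λ a x → (x :- (con 1ℚ :- con (1ℚ ℚ.+ 1ℚ) :* a)) :+ (con 1ℚ :- a) :* (con 1ℚ :- x)
                 := a :* (x :- con (ℚ.- 1ℚ))) refl (seq α n) (seq x n))) ⟩
    k * (α * (x - - 1ℝ))
      ≈⟨ pointwise-≋ (λ n → sym (ℚ.*-assoc (seq k n) (seq α n) (seq x n ℚ.- (ℚ.- 1ℚ)))) ⟩
    (k * α) * (x - - 1ℝ)
      ≈⟨ *-congʳ-≋ (k * α) σ (x - - 1ℝ) kα≋σ ⟩
    σ * (x - - 1ℝ) ∎

  const-hinge-close : ∀ x → - 1ℝ ≼ x → x ≼ 1ℝ →
    ∣ σ - k * (0ℝ ⊔ (x - (1ℝ - 2ℝ * α))) ∣ ≼ σ
  const-hinge-close x -1≼x x≼1 = ∣∣-lub (σ - k * (0ℝ ⊔ (x - (1ℝ - 2ℝ * α))))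
    (≼-by (hinge-nonneg k (1ℝ - 2ℝ * α) x 0≼k) λ n →
      solve 2 (λ s h → (s :- h) :+ h := s) refl
        (seq σ n) (seq (k * (0ℝ ⊔ (x - (1ℝ - 2ℝ * α)))) n))
    -- The other side, f - σ ≤ σ, follows from f ≤ σ(x + 1) ≤ 2σ.
    (≼-by (+-nonneg (diff-nonneg (hinge-≼-chord x -1≼x x≼1))
                    (*-nonneg 0≼σ (diff-nonneg x≼1))) λ n →
      solve 3 (λ s x h → (:- (s :- h)) :+
          ((s :* (x :- con (ℚ.- 1ℚ)) :- h) :+ s :* (con 1ℚ :- x)) := s) refl
        (seq σ n) (seq x n) (seq (k * (0ℝ ⊔ (x - (1ℝ - 2ℝ * α)))) n))

-- The competitor σ(x + α) and the lower bound for the projection.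

module Projection (σ α k : ℝ) (0≼σ : 0ℝ ≼ σ) (0<α : 0ℝ < α) (α<½ : α < ½ℝ)
  (kα≋σ : k * α ≋ σ) (f : ℝ → ℝ)
  (f-left : ∀ x → x ≼ 1ℝ - 2ℝ * α → f x ≋ 0ℝ)
  (f-right : ∀ x → 1ℝ - 2ℝ * α ≼ x → f x ≋ k * (x - (1ℝ - 2ℝ * α))) where

  open Breakpoint α 0<α α<½
  open Residual f k (1ℝ - 2ℝ * α) f-left f-right

  f-at-1 : f 1ℝ ≋ 2ℝ * σ
  f-at-1 = begin-equality
    f 1ℝ
      ≈⟨ f-right 1ℝ b≼1 ⟩
    k * (1ℝ - (1ℝ - 2ℝ * α))
      ≈⟨ pointwise-≋ (λ n → solve 2
           (λ k a → k :* (con 1ℚ :- (con 1ℚ :- con (1ℚ ℚ.+ 1ℚ) :* a))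
             := con (1ℚ ℚ.+ 1ℚ) :* (k :* a)) refl (seq k n) (seq α n)) ⟩
    2ℝ * (k * α)
      ≈⟨ *-congˡ-≋ 2ℝ (k * α) σ 0≼2 kα≋σ ⟩
    2ℝ * σ ∎

  0≼E : 0ℝ ≼ σ * (1ℝ - α)
  0≼E = *-nonneg {σ} {1ℝ - α} 0≼σ 0≼1-α

  -E≼E : - (σ * (1ℝ - α)) ≼ σ * (1ℝ - α)
  -E≼E = ≼-by (+-nonneg 0≼E 0≼E) λ n →
    solve 1 (λ e → (:- e) :+ (e :+ e) := e) refl (seq (σ * (1ℝ - α)) n)

  ∣∣≼E⁺ : ∀ x → x ≋ σ * (1ℝ - α) → ∣ x ∣ ≼ σ * (1ℝ - α)
  ∣∣≼E⁺ x x≋E = ∣∣≼-resp-≋ x (σ * (1ℝ - α)) x≋E ≼-refl -E≼E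

  ∣∣≼E⁻ : ∀ x → x ≋ - (σ * (1ℝ - α)) → ∣ x ∣ ≼ σ * (1ℝ - α)
  ∣∣≼E⁻ x x≋-E = ∣∣≼-resp-≋ x (- (σ * (1ℝ - α))) x≋-E -E≼E
    (≼-by (diff-nonneg (≼-refl {σ * (1ℝ - α)})) λ n →
      solve 1 (λ e → (:- (:- e)) :+ (e :- e) := e) refl (seq (σ * (1ℝ - α)) n))

  -- The residuals at -1, b = 1 - 2α and 1 are E, -E and E, where E = σ(1 - α).
  equioscillation :
      ∣ f (- 1ℝ) - ⟦ σ * α ∷ σ ∷ [] ⟧ (- 1ℝ) ∣ ≼ σ * (1ℝ - α)
    × ∣ f (1ℝ - 2ℝ * α) - ⟦ σ * α ∷ σ ∷ [] ⟧ (1ℝ - 2ℝ * α) ∣ ≼ σ * (1ℝ - α)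
    × ∣ f 1ℝ - ⟦ σ * α ∷ σ ∷ [] ⟧ 1ℝ ∣ ≼ σ * (1ℝ - α)
  equioscillation =
      ∣∣≼E⁺ (f (- 1ℝ) - ⟦ σ * α ∷ σ ∷ [] ⟧ (- 1ℝ))
        (≋-trans (residual-left (σ * α) σ (- 1ℝ) -1≼b)
          (pointwise-≋ λ n → solve 2
            (λ s a → (:- (s :* a)) :+ (:- s) :* con (ℚ.- 1ℚ) := s :* (con 1ℚ :- a)) refl
            (seq σ n) (seq α n)))
    , ∣∣≼E⁻ (f (1ℝ - 2ℝ * α) - ⟦ σ * α ∷ σ ∷ [] ⟧ (1ℝ - 2ℝ * α))
        (≋-trans (residual-left (σ * α) σ (1ℝ - 2ℝ * α) ≼-refl)
          (pointwise-≋ λ n → solve 2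
            (λ s a → (:- (s :* a)) :+ (:- s) :* (con 1ℚ :- con (1ℚ ℚ.+ 1ℚ) :* a)
              := :- (s :* (con 1ℚ :- a))) refl
            (seq σ n) (seq α n)))
    , ∣∣≼E⁺ (f 1ℝ - ⟦ σ * α ∷ σ ∷ [] ⟧ 1ℝ)
        (≋-trans (+-congʳ-≋ (f 1ℝ) (2ℝ * σ) (- ⟦ σ * α ∷ σ ∷ [] ⟧ 1ℝ) f-at-1)
          (pointwise-≋ λ n → solve 2
            (λ s a → con (1ℚ ℚ.+ 1ℚ) :* s :- (s :* a :+ con 1ℚ :* (s :+ con 1ℚ :* con 0ℚ))
              := s :* (con 1ℚ :- a)) refl
            (seq σ n) (seq α n)))

  module _ (c₀ c₁ : ℝ)
    (close-at-b : ∣ f (1ℝ - 2ℝ * α) - ⟦ c₀ ∷ c₁ ∷ [] ⟧ (1ℝ - 2ℝ * α) ∣ ≼ σ * (1ℝ - α))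
    (close-at-1 : ∣ f 1ℝ - ⟦ c₀ ∷ c₁ ∷ [] ⟧ 1ℝ ∣ ≼ σ * (1ℝ - α)) where

    -- Closeness gives q(b) - f(b) ≤ E, and f(b) = 0.
    upper-at-b : ⟦ c₀ ∷ c₁ ∷ [] ⟧ (1ℝ - 2ℝ * α) ≼ σ * (1ℝ - α)
    upper-at-b = ≼-by
      (+-nonneg
        (diff-nonneg (≼-trans (-x≼∣x∣ (f (1ℝ - 2ℝ * α) - ⟦ c₀ ∷ c₁ ∷ [] ⟧ (1ℝ - 2ℝ * α)))
          close-at-b))
        (diff-nonneg (proj₁ (f-left (1ℝ - 2ℝ * α) ≼-refl))))
      λ n → solve 3 (λ q e y → q :+ ((e :- (:- (y :- q))) :+ (con 0ℚ :- y)) := e) refl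
        (seq (⟦ c₀ ∷ c₁ ∷ [] ⟧ (1ℝ - 2ℝ * α)) n) (seq (σ * (1ℝ - α)) n)
        (seq (f (1ℝ - 2ℝ * α)) n)

    -- Closeness gives f(1) - q(1) ≤ E, and f(1) = 2σ.
    lower-at-1 : 2ℝ * σ - ⟦ c₀ ∷ c₁ ∷ [] ⟧ 1ℝ ≼ σ * (1ℝ - α)
    lower-at-1 = ≼-by
      (+-nonneg
        (diff-nonneg (≼-trans (x≼∣x∣ (f 1ℝ - ⟦ c₀ ∷ c₁ ∷ [] ⟧ 1ℝ)) close-at-1))
        (diff-nonneg (proj₂ f-at-1)))
      λ n → solve 4 (λ s q e y → (s :- q) :+ ((e :- (y :- q)) :+ (y :- s)) := e) refl
        (seq (2ℝ * σ) n) (seq (⟦ c₀ ∷ c₁ ∷ [] ⟧ 1ℝ) n) (seq (σ * (1ℝ - α)) n)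
        (seq (f 1ℝ) n)

    -- With E = σ(1 - α):
    -- α(-E - q(-1)) = (E - q(b)) + (1 - α)(E - (2σ - q(1))).
    slack-at--1 : 0ℝ ≼ - (σ * (1ℝ - α)) - ⟦ c₀ ∷ c₁ ∷ [] ⟧ (- 1ℝ)
    slack-at--1 = *-cancelˡ-nonneg α (- (σ * (1ℝ - α)) - ⟦ c₀ ∷ c₁ ∷ [] ⟧ (- 1ℝ)) 0<α
      (≼-by
        (+-nonneg (diff-nonneg upper-at-b)
          (*-nonneg 0≼1-α (diff-nonneg lower-at-1)))
        λ n → solve 4
          (λ s a d e →
            let two = con (1ℚ ℚ.+ 1ℚ)
                amp = s :* (con 1ℚ :- a)
                q   = λ x → d :+ x :* (e :+ x :* con 0ℚ)
            in con 0ℚ :+ ((amp :- q (con 1ℚ :- two :* a))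
                 :+ (con 1ℚ :- a) :* (amp :- (two :* s :- q (con 1ℚ))))
               := a :* ((:- amp) :- q (con (ℚ.- 1ℚ)))) refl
          (seq σ n) (seq α n) (seq c₀ n) (seq c₁ n))

    far-at--1 : (2ℝ - α) * σ ≼ σ - ⟦ c₀ ∷ c₁ ∷ [] ⟧ (- 1ℝ)
    far-at--1 = ≼-by slack-at--1 λ n → solve 3
      (λ s a q → (con (1ℚ ℚ.+ 1ℚ) :- a) :* s :+ ((:- (s :* (con 1ℚ :- a))) :- q) := s :- q)
      refl (seq σ n) (seq α n) (seq (⟦ c₀ ∷ c₁ ∷ [] ⟧ (- 1ℝ)) n)

  projection-far : ∀ c₀ c₁ → IsℓInfProjection 1 f (c₀ ∷ c₁ ∷ []) →
    ∃[ s ] (‖ (λ x → σ - ⟦ c₀ ∷ c₁ ∷ [] ⟧ x) ‖∞≡ s × (2ℝ - α) * σ ≤ s)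
  projection-far c₀ c₁ optimal =
    -- Optimality compares only norms that are known to exist, so both residual norms are
    -- constructed first.
    let (s , s-norm , _)     = residual-norm c₀ c₁ -1≼b b≼1
        (t , t-norm , least) = residual-norm (σ * α) σ -1≼b b≼1
        (at--1 , at-b , at-1) = equioscillation
        -- Optimality against σ(x + α) gives s ≤ t, and the three node values of that line give t ≤
        -- E.
        s≼E = ≼-trans (≤⇒≼ {s} {t} (optimal (σ * α ∷ σ ∷ []) s t s-norm t-norm))
                      (least (σ * (1ℝ - α)) at--1 at-b at-1)
        b∈ = to-≤ (- 1ℝ) (1ℝ - 2ℝ * α) -1≼b , to-≤ (1ℝ - 2ℝ * α) 1ℝ b≼1
        (v , v-norm) = const-minus-line-norm σ c₀ c₁
    in v , v-norm , to-≤ ((2ℝ - α) * σ) v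
      -- The norm of `σ - q` is at least its value at -1, where `far-at--1` applies.
      (≼-trans
        (far-at--1 c₀ c₁
          (≼-trans (≤⇒≼ (proj₁ s-norm (1ℝ - 2ℝ * α) b∈)) s≼E)
          (≼-trans (≤⇒≼ (proj₁ s-norm 1ℝ 1∈)) s≼E))
        (≼-trans (x≼∣x∣ (σ - ⟦ c₀ ∷ c₁ ∷ [] ⟧ (- 1ℝ))) (≤⇒≼ (proj₁ v-norm (- 1ℝ) -1∈))))

lemma5p5 : (σ α : ℝ) (0<σ : 0ℝ < σ) (0<α : 0ℝ < α) (α<½ : α < ½ℝ) →
    let p : ℝ → ℝ
        p x = σ
        f : ℝ → ℝ
        f x = σ / α [ 0<α ] * (0ℝ ⊔ (x - (1ℝ - 2ℝ * α)))
    in (∀ x → x ∈[-1,1] → ∣ p x - f x ∣ ≤ σ)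
       × ((q : Poly≤ 1) → IsℓInfProjection 1 f q →
          ∃[ s ] (‖ (λ x → p x - ⟦ q ⟧ x) ‖∞≡ s × (2ℝ - α) * σ ≤ s))
lemma5p5 σ α 0<σ 0<α α<½ =
    (λ x (-1≤x , x≤1) → to-≤ ∣ σ - σ / α [ 0<α ] * (0ℝ ⊔ (x - (1ℝ - 2ℝ * α))) ∣ σ
      (Hinge.const-hinge-close σ α (σ / α [ 0<α ]) 0≼σ 0<α α<½ 0≼k (/-cancel σ α 0<α)
        x (≤⇒≼ -1≤x) (≤⇒≼ x≤1)))
  , λ { (c₀ ∷ c₁ ∷ []) → Projection.projection-far σ α (σ / α [ 0<α ]) 0≼σ 0<α α<½
          (/-cancel σ α 0<α)
          (λ x → σ / α [ 0<α ] * (0ℝ ⊔ (x - (1ℝ - 2ℝ * α))))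
          (λ x → hinge-left (σ / α [ 0<α ]) (1ℝ - 2ℝ * α) x 0≼k)
          (λ x → hinge-right (σ / α [ 0<α ]) (1ℝ - 2ℝ * α) x 0≼k)
          c₀ c₁ }
  where
  0≼σ : 0ℝ ≼ σ
  0≼σ = <⇒≼ {0ℝ} {σ} 0<σ
  0≼k : 0ℝ ≼ σ / α [ 0<α ]
  0≼k = /-nonneg σ α 0≼σ 0<α
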